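{- Let $\mathrm{Spec}\subseteq\mathcal{E}^\ast$ be a specification. For every trace $E\in\mathcal{T}$ and every $i\in\mathbb{N}$, the trace $E\downharpoonright i$ is linearizable, i.e. $\mathrm{lin}(E,i)$ holds, if and only if the threads together with the observer do not know that it is incorrect, i.e. $(E,i)\models\neg D_{\mathrm{Threads}\uplus\{\mathit{obs}\}}(\neg\,\mathit{correct})$.
   Context: Let $\mathrm{Threads}$, $\mathrm{Methods}$, $\mathrm{Values}$ be sets and let $\mathit{env}\notin\mathrm{Threads}$ be an extra agent (the environment). Actions are $\mathit{inv}(m,v)$ (invocation) and $\mathit{ret}(m,v)$ (return) with $m\in\mathrm{Methods}$, $v\in\mathrm{Values}$; $\mathcal{A}$ is the set of actions. Events are pairs $(t,\mathit{act})$ with $t\in\mathrm{Threads}\uplus\{\mathit{env}\}$ and $\mathit{act}\in\mathcal{A}$; $\mathcal{E}$ is the set of events. $\mathrm{Inv}$ is the set of events of the form $(t,\mathit{inv}(m,v))$ and $\mathrm{Ret}$ the set of events of the form $(t,\mathit{ret}(m,v))$. $\mathcal{E}^\ast$, $\mathcal{E}^\omega$ are the finite and the infinite sequences over $\mathcal{E}$; positions start at $1$, $E@j$ is the element of $E$ at position $j$, and $E\downharpoonright i$ is the prefix up to and including position $i$. Standing assumption: each event occurs at most once in a trace, so the traces are the elements of $\mathcal{T}=\{E\in\mathcal{E}^\omega : E@j=E@k\Rightarrow j=k\text{ for all }j,k\}$. For an event $e$ occurring in $E$, $\mathrm{pos}(e,E)$ is its position; $\mathrm{pos}(e,E)=\omega$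 if $e$ does not occur. For $t\in\mathrm{Threads}$, $E\downarrow t$ is obtained from the sequence $E$ by erasing all events not of the form $(t,\mathit{act})$ with $\mathit{act}\in\mathcal{A}$. Indistinguishability relations on $\mathcal{T}\times\mathbb{N}$: $(E,i)\sim_t(E',i')$ iff $(E\downharpoonright i)\downarrow t=(E'\downharpoonright i')\downarrow t$; $\sim_{\mathrm{Threads}}=\bigcap_{t\in\mathrm{Threads}}\sim_t$; $\mathrm{obs}(E,i)=\{(r,\mathit{in})\in\mathrm{Ret}\times\mathrm{Inv} : \mathrm{pos}(r,E)<\mathrm{pos}(\mathit{in},E)\le i\}$; $(E,i)\preceq_{\mathit{obs}}(E',i')$ iff $\mathrm{obs}(E,i)\subseteq\mathrm{obs}(E',i')$; and $\sim_{\mathrm{Threads}\uplus\{\mathit{obs}\}}=\sim_{\mathrm{Threads}}\cap\preceq_{\mathit{obs}}$. Satisfaction: $(E,i)\models\mathit{correct}$ iff $E\downharpoonright i\in\mathrm{Spec}$; $(E,i)\models\neg\varphi$ iff not $(E,i)\models\varphi$; $(E,i)\models D_{\mathrm{Threads}\uplus\{\mathit{obs}\}}(\varphi)$ iff $(E',i')\models\varphi$ for all $(E',i')\in\mathcal{T}\times\mathbb{N}$ with $(E,i)\sim_{\mathrm{Threads}\uplus\{\mathit{obs}\}}(E',i')$. Real-time precedence: $(E,i)\preceq_{\mathit{real}}(E',i')$ iff there is a bijection $\pi:\{1,\dots,i\}\to\{1,\dots,i'\}$ such that $E@j=E'@\pi(j)$ for all $1\le j\le i$, and for all $1\le j<k\le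 i$, if $E@j\in\mathrm{Ret}$ and $E@k\in\mathrm{Inv}$ then $\pi(j)<\pi(k)$. Linearizability: $\mathrm{lin}(E,i)$ holds iff there is $(E',i')\in\mathcal{T}\times\mathbb{N}$ such that (1) $(E\downharpoonright i)\downarrow t=(E'\downharpoonright i')\downarrow t$ for all $t\in\mathrm{Threads}$; (2) $(E,i)\preceq_{\mathit{real}}(E',i')$; (3) $E'\downharpoonright i'\in\mathrm{Spec}$.
   Formalization: The formal theorem additionally assumes that no sequence in Spec and no position of the prefix of E up to i contains an event of the environment; without this the equivalence fails, e.g. for Spec consisting of the single sequence ⟨(env, inv(m,v))⟩ and i = 0. -}

module Defs where

open import Axiom.ExcludedMiddle using (ExcludedMiddle)
open import Data.Fin.Base as Fin using (Fin; toℕ)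
open import Data.List.Base using (List; applyUpTo; filter)
open import Data.List.Relation.Unary.All using (All)
open import Data.Nat.Base using (ℕ; suc; _<_; _≤_)
open import Data.Product.Base using (∃; ∃₂; _×_; _,_; proj₁)
open import Function.Bundles using (_⤖_; module Bijection)
open import Function.Definitions using (Injective)
open import Level using (0ℓ)
open import Relation.Binary.Core using (Rel)
open import Relation.Binary.PropositionalEquality.Core using (_≡_; _≢_)
open import Relation.Nullary.Construct.Add.Supremum using (_⁺; ⊤⁺; [_])
open import Relation.Nullary.Decidable.Core using (yes; no)
open import Relation.Nullary.Negation.Core using (¬_)
open import Relation.Unary using (Pred; _⊆_)

open import Relation.Binary.Construct.Add.Supremum.Strict _<_ using (_<⁺_)
open import Relation.Binary.Construct.Add.Supremum.NonStrict _≤_ using (_≤⁺_)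

-- The mathematics is classical: erasing the events of the other threads from a
-- sequence, and the position (possibly ω) of an event in an infinite trace, are
-- functions only in the presence of excluded middle.

module Traces (em : ExcludedMiddle 0ℓ) (Threads Methods Values : Set) where

  data Agent : Set where
    thread : Threads → Agent
    env    : Agent

  data Action : Set where
    inv ret : Methods → Values → Action

  Event : Set
  Event = Agent × Action

  Inv Ret : Pred Event 0ℓ
  Inv e = ∃ λ t → ∃₂ λ m v → e ≡ (t , inv m v)
  Ret e = ∃ λ t → ∃₂ λ m v → e ≡ (t , ret m v)

  -- E at k is the element at position k + 1, positions being counted from 1.

  record Trace : Set where
    infix 20 _at_
    field
      _at_       : ℕ → Event
      injective : Injective _≡_ _≡_ _at_

  open Trace public using (_at_)

  Point : Set
  Point = Trace × ℕ

  infixl 10 _⇂_ _↓_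

  _⇂_ : Trace → ℕ → List Event
  E ⇂ i = applyUpTo (E at_) i

  ByThread : Threads → Pred Event 0ℓ
  ByThread t e = ∃ λ act → e ≡ (thread t , act)

  _↓_ : List Event → Threads → List Event
  w ↓ t = filter (λ e → em {ByThread t e}) w

  EnvFree : Pred (List Event) 0ℓ
  EnvFree = All (λ e → proj₁ e ≢ env)

  -- ⊤⁺ is the position ω of an event that does not occur.

  pos : Event → Trace → ℕ ⁺
  pos e E with em {∃ λ k → E at k ≡ e}
  ... | yes (k , _) = [ suc k ]
  ... | no _        = ⊤⁺

  obs : Point → Pred (Event × Event) 0ℓ
  obs (E , i) (r , in′) =
    Ret r × Inv in′ × pos r E <⁺ pos in′ E × pos in′ E ≤⁺ [ i ]

  infix 4 _∼[_]_ _∼Threads_ _≼obs_ _∼Threads⊎obs_ _≼real_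

  _∼[_]_ : Point → Threads → Point → Set
  (E , i) ∼[ t ] (E′ , i′) = (E ⇂ i) ↓ t ≡ (E′ ⇂ i′) ↓ t

  _∼Threads_ : Rel Point 0ℓ
  p ∼Threads q = ∀ t → p ∼[ t ] q

  _≼obs_ : Rel Point 0ℓ
  p ≼obs q = obs p ⊆ obs q

  _∼Threads⊎obs_ : Rel Point 0ℓ
  p ∼Threads⊎obs q = p ∼Threads q × p ≼obs q

  _≼real_ : Rel Point 0ℓ
  (E , i) ≼real (E′ , i′) = ∃ λ (π : Fin i ⤖ Fin i′) →
    let open Bijection π using (to) in
    (∀ j → E at toℕ j ≡ E′ at toℕ (to j)) ×
    (∀ j k → j Fin.< k → Ret (E at toℕ j) → Inv (E at toℕ k) → to j Fin.< to k)

  infix 25 ¬′_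

  data Formula : Set where
    correct       : Formula
    ¬′_           : Formula → Formula
    D-Threads⊎obs : Formula → Formula

  module Specified (Spec : Pred (List Event) 0ℓ) where

    infix 4 _⊨_

    _⊨_ : Point → Formula → Set
    (E , i) ⊨ correct         = Spec (E ⇂ i)
    p       ⊨ ¬′ φ            = ¬ (p ⊨ φ)
    p       ⊨ D-Threads⊎obs φ = ∀ q → p ∼Threads⊎obs q → q ⊨ φ

    lin : Pred Point 0ℓ
    lin (E , i) = ∃₂ λ E′ i′ →
      (∀ t → (E ⇂ i) ↓ t ≡ (E′ ⇂ i′) ↓ t) ×
      (E , i) ≼real (E′ , i′) ×
      Spec (E′ ⇂ i′)

{-# OPTIONS --safe #-}

-- Between traces without environment events, ∼Threads already forces the two
-- prefixes to contain the same events, so that, events being unrepeated, there is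
-- exactly one event-preserving bijection π of their positions.  That π respects
-- the real-time order is then precisely the inclusion of the observations.

module Submission where

open import Defs
open import Axiom.DoubleNegationElimination using (em⇒dne)
open import Axiom.ExcludedMiddle using (ExcludedMiddle)
open import Data.Fin.Base as Fin using (Fin; toℕ; fromℕ<)
open import Data.Fin.Properties using (toℕ<n; toℕ-fromℕ<; toℕ-injective)
open import Data.List.Base using (List)
open import Data.List.Membership.Propositional using (_∈_)
open import Data.List.Membership.Propositional.Properties
  using (∈-applyUpTo⁺; ∈-applyUpTo⁻; ∈-filter⁺; ∈-filter⁻)
open import Data.List.Relation.Unary.All using (lookup)
open import Data.Nat.Base using (ℕ; suc; _<_; _≤_; s<s; s<s⁻¹)
open import Data.Nat.Properties using (<-trans)
open import Data.Product.Base using (∃; ∃₂; _×_; _,_; proj₁; proj₂)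
open import Function.Base using (_∘_)
open import Function.Bundles using (_⇔_; mk⇔; mk⤖; module Bijection)
open import Function.Consequences.Propositional using (strictlySurjective⇒surjective)
open import Level using (0ℓ)
open import Relation.Binary.Construct.Add.Supremum.NonStrict _≤_ using (_≤⁺_; [_])
open import Relation.Binary.Construct.Add.Supremum.Strict _<_ using (_<⁺_; [_])
open import Relation.Binary.PropositionalEquality
  using (_≡_; _≢_; refl; sym; trans; cong; subst; subst₂)
open import Relation.Nullary.Construct.Add.Supremum using ([_])
open import Relation.Nullary.Decidable.Core using (yes; no)
open import Relation.Nullary.Negation.Core using (contradiction)
open import Relation.Unary using (Pred; _⊆_)

module _ (em : ExcludedMiddle 0ℓ) (Threads Methods Values : Set) where

  open Traces em Threads Methods Values

  pos-at : ∀ E k → pos (E at k) E ≡ [ suc k ]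
  pos-at E k with em {∃ λ l → E at l ≡ E at k}
  ... | yes (_ , eq) = cong (λ l → [ suc l ]) (Trace.injective E eq)
  ... | no  ∄l       = contradiction (k , refl) ∄l

  obs⁺ : ∀ E {i j k} → j < k → k < i → Ret (E at j) → Inv (E at k) →
         obs (E , i) (E at j , E at k)
  obs⁺ E {i} {j} {k} j<k k<i r∈Ret in∈Inv =
    r∈Ret , in∈Inv ,
    subst₂ _<⁺_ (sym (pos-at E j)) (sym (pos-at E k)) [ s<s j<k ] ,
    subst (_≤⁺ [ i ]) (sym (pos-at E k)) [ k<i ]

  obs⁻ : ∀ E {i r in′} → obs (E , i) (r , in′) →
         ∃₂ λ j k → j < k × k < i × E at j ≡ r × E at k ≡ in′
  obs⁻ E {i} {r} {in′} (_ , _ , r<in , in≤i)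
    with em {∃ λ j → E at j ≡ r} | em {∃ λ k → E at k ≡ in′}
  obs⁻ E (_ , _ , [ j<k ] , [ k<i ]) | yes (j , Ej≡r) | yes (k , Ek≡in) =
    j , k , s<s⁻¹ j<k , k<i , Ej≡r , Ek≡in
  obs⁻ E (_ , _ , _ , ()) | yes _ | no _
  obs⁻ E (_ , _ , () , _) | no _  | _

  obs-at⇒< : ∀ E {i j k} → obs (E , i) (E at j , E at k) → j < k
  obs-at⇒< E o with obs⁻ E o
  ... | _ , _ , j<k , _ , eqʲ , eqᵏ =
    subst₂ _<_ (Trace.injective E eqʲ) (Trace.injective E eqᵏ) j<k

  ≼real⇒≼obs : ∀ {p q} → p ≼real q → p ≼obs q
  ≼real⇒≼obs {E , i} {E′ , i′} (π , same , mono) o@(r∈Ret , in∈Inv , _)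
    with obs⁻ E o
  ... | j , k , j<k , k<i , refl , refl =
    subst₂ (λ r in′ → obs (E′ , i′) (r , in′)) (sym r≡) (sym in≡)
      (obs⁺ E′ πj<πk (toℕ<n (to k′)) (subst Ret r≡ r∈Ret) (subst Inv in≡ in∈Inv))
    where
    open Bijection π using (to)

    j<i = <-trans j<k k<i
    j′  = fromℕ< j<i
    k′  = fromℕ< k<i
    j′≡j = toℕ-fromℕ< j<i
    k′≡k = toℕ-fromℕ< k<i

    r≡ : E at j ≡ E′ at toℕ (to j′)
    r≡ = trans (cong (E at_) (sym j′≡j)) (same j′)

    in≡ : E at k ≡ E′ at toℕ (to k′)
    in≡ = trans (cong (E at_) (sym k′≡k)) (same k′)

    πj<πk : to j′ Fin.< to k′
    πj<πk = mono j′ k′ (subst₂ _<_ (sym j′≡j) (sym k′≡k) j<k)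
      (subst Ret (cong (E at_) (sym j′≡j)) r∈Ret)
      (subst Inv (cong (E at_) (sym k′≡k)) in∈Inv)

  ∼Threads-sym : ∀ {p q} → p ∼Threads q → q ∼Threads p
  ∼Threads-sym p∼q t = sym (p∼q t)

  ∼Threads⇒∈ : ∀ {E i E′ i′ e} → (E , i) ∼Threads (E′ , i′) →
               proj₁ e ≢ env → e ∈ E ⇂ i → e ∈ E′ ⇂ i′
  ∼Threads⇒∈ {e = env , _}        _   e≢env _ = contradiction refl e≢env
  ∼Threads⇒∈ {E′ = E′} {i′} {thread t , act} p∼q _     e∈E =
    proj₁ (∈-filter⁻ (λ e → em {ByThread t e}) {xs = E′ ⇂ i′}
      (subst (_ ∈_) (p∼q t) (∈-filter⁺ (λ e → em {ByThread t e}) e∈E (act , refl))))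

  ∼Threads⇒position : ∀ {E i E′ i′} → (E , i) ∼Threads (E′ , i′) → EnvFree (E ⇂ i) →
                      (j : Fin i) → ∃ λ (k : Fin i′) → E at toℕ j ≡ E′ at toℕ k
  ∼Threads⇒position {E} {i} {E′} {i′} p∼q envFree j
    with e∈E ← ∈-applyUpTo⁺ (E at_) (toℕ<n j)
    with k , k<i′ , eq ← ∈-applyUpTo⁻ (E′ at_)
           (∼Threads⇒∈ {E} {i} {E′} {i′} p∼q (lookup envFree e∈E) e∈E) =
    fromℕ< k<i′ , trans eq (cong (E′ at_) (sym (toℕ-fromℕ< k<i′)))

  ∼Threads⊎obs⇒≼real : ∀ {E i E′ i′} → EnvFree (E ⇂ i) → EnvFree (E′ ⇂ i′) →
                       (E , i) ∼Threads⊎obs (E′ , i′) → (E , i) ≼real (E′ , i′)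
  ∼Threads⊎obs⇒≼real {E} {i} {E′} {i′} envFree envFree′ (p∼q , p≼q) =
    mk⤖ (to-injective , strictlySurjective⇒surjective to-surjective) , same , mono
    where
    position : ∀ j → ∃ λ k → E at toℕ j ≡ E′ at toℕ k
    position = ∼Threads⇒position {E} {i} {E′} {i′} p∼q envFree

    to : Fin i → Fin i′
    to = proj₁ ∘ position

    same : ∀ j → E at toℕ j ≡ E′ at toℕ (to j)
    same = proj₂ ∘ position

    to-injective : ∀ {j k} → to j ≡ to k → j ≡ k
    to-injective {j} {k} eq = toℕ-injective (Trace.injective E
      (trans (same j) (trans (cong (λ l → E′ at toℕ l) eq) (sym (same k)))))

    to-surjective : ∀ k → ∃ λ j → to j ≡ k
    to-surjective k
      with j , eq ← ∼Threads⇒position {E′} {i′} {E} {i}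
             (∼Threads-sym {E , i} {E′ , i′} p∼q) envFree′ k =
      j , toℕ-injective (Trace.injective E′ (sym (trans eq (same j))))

    mono : ∀ j k → j Fin.< k → Ret (E at toℕ j) → Inv (E at toℕ k) → to j Fin.< to k
    mono j k j<k r∈Ret in∈Inv = obs-at⇒< E′ {i′}
      (subst₂ (λ r in′ → obs (E′ , i′) (r , in′)) (same j) (same k)
        (p≼q (obs⁺ E j<k (toℕ<n k) r∈Ret in∈Inv)))

theorem3 : (em : ExcludedMiddle 0ℓ) (Threads Methods Values : Set) →
    let open Traces em Threads Methods Values in
    (Spec : Pred (List Event) 0ℓ) → Spec ⊆ EnvFree →
    let open Specified Spec in
    (E : Trace) (i : ℕ) → EnvFree (E ⇂ i) →
    lin (E , i) ⇔ ((E , i) ⊨ ¬′ D-Threads⊎obs (¬′ correct))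
theorem3 em Threads Methods Values Spec Spec⊆EnvFree E i envFree = mk⇔
  (λ (E′ , i′ , p∼q , p≼q , spec) known →
    known (E′ , i′)
      (p∼q , ≼real⇒≼obs em Threads Methods Values {E , i} {E′ , i′} p≼q) spec)
  (λ unknown → em⇒dne em λ ¬lin → unknown λ (E′ , i′) p∼q spec →
    ¬lin (E′ , i′ , proj₁ p∼q ,
      ∼Threads⊎obs⇒≼real em Threads Methods Values {E} {i} {E′} {i′}
        envFree (Spec⊆EnvFree spec) p∼q ,
      spec))
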